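{- For any strongly dense selection frame $(W,\{R_A\}_{A\subseteq W})$, the operation $\to_R$ on $\wp(W)$ defined by $$A\to_R B:=\{w\in W\mid \text{for all } v\in W,\ wR_Av\Rightarrow v\in B\}$$ is a preconditional on the Boolean algebra $\wp(W)$.
   Context: A preconditional on a bounded lattice $L$ is a binary operation $\to$ on $L$ such that for all $a,b,c\in L$: (1) $1\to a\leq a$; (2) $a\wedge b\leq a\to b$; (3) $a\to b\leq a\to(a\wedge b)$; (4) $a\to(b\wedge c)\leq a\to b$; (5) $a\to((a\wedge b)\to c)\leq (a\wedge b)\to c$. A selection frame is a pair $(W,\{R_A\}_{A\subseteq W})$ where $W$ is a nonempty set and each $R_A$ is a binary relation on $W$ such that for all $w,v\in W$ and $A\subseteq W$: (success) if $wR_Av$, then $v\in A$; (centering) if $w\in A$, then $wR_Av$ iff $v=w$. It is strongly dense if for all $w,v\in W$ and $A,B\subseteq W$: if $wR_{A\cap B}v$, then there is $u\in W$ with $wR_Au$ and $uR_{A\cap B}v$. -}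

module Defs where

open import Algebra.Core using (Op₂)
open import Algebra.Definitions using (Congruent₂)
open import Axiom.ExcludedMiddle using (ExcludedMiddle)
open import Data.Product.Base using (∃-syntax; _×_; _,_; proj₁; proj₂; <_,_>)
open import Data.Sum.Base using (inj₁; inj₂; [_,_])
open import Function.Bundles using (_⇔_)
open import Level using (Level; suc; _⊔_)
open import Relation.Binary.Core using (Rel)
open import Relation.Binary.Lattice.Bundles using (BoundedLattice; BooleanAlgebra)
open import Relation.Binary.Lattice.Structures using (IsBoundedLattice)
open import Relation.Binary.PropositionalEquality.Core using (_≡_)
open import Relation.Nullary.Decidable.Core using (yes; no)
open import Relation.Nullary.Negation.Core using (contradiction)
open import Relation.Unary using (Pred; _∈_; _⊆_; _≐_; _∩_; _∪_; ∁)
open import Relation.Unary.Polymorphic using (∅; U)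
open import Relation.Unary.Relation.Binary.Subset using (⊆-isPartialOrder)

-- The equality of a BoundedLattice is an arbitrary equivalence relation, so
-- being an operation on the lattice includes compatibility with it.
record IsPreconditional {c ℓ₁ ℓ₂ : Level} (L : BoundedLattice c ℓ₁ ℓ₂)
                        (_⟶_ : Op₂ (BoundedLattice.Carrier L))
                        : Set (c ⊔ ℓ₁ ⊔ ℓ₂) where
  open BoundedLattice L
  field
    ⟶-cong         : Congruent₂ _≈_ _⟶_
    ⊤⟶a≤a          : ∀ a → (⊤ ⟶ a) ≤ a
    a∧b≤a⟶b        : ∀ a b → (a ∧ b) ≤ (a ⟶ b)
    a⟶b≤a⟶a∧b      : ∀ a b → (a ⟶ b) ≤ (a ⟶ (a ∧ b))
    a⟶b∧c≤a⟶b      : ∀ a b c → (a ⟶ (b ∧ c)) ≤ (a ⟶ b)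
    a⟶a∧b⟶c≤a∧b⟶c  : ∀ a b c → (a ⟶ ((a ∧ b) ⟶ c)) ≤ ((a ∧ b) ⟶ c)

-- Subsets are predicates ordered by inclusion, with extensional equality _≐_.
℘ : {ℓ : Level} → Set ℓ → BoundedLattice (suc ℓ) ℓ ℓ
℘ {ℓ} W = record
  { Carrier          = Pred W ℓ
  ; _≈_              = _≐_
  ; _≤_              = _⊆_
  ; _∨_              = _∪_
  ; _∧_              = _∩_
  ; ⊤                = U
  ; ⊥                = ∅
  ; isBoundedLattice = isBoundedLattice
  }
  where
  isBoundedLattice : IsBoundedLattice {A = Pred W ℓ} _≐_ _⊆_ _∪_ _∩_ U ∅
  isBoundedLattice = record
    { isLattice = record
      { isPartialOrder = ⊆-isPartialOrder
      ; supremum       = λ _ _ → inj₁ , inj₂ , λ _ P⊆R Q⊆R → [ P⊆R , Q⊆R ]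
      ; infimum        = λ _ _ → proj₁ , proj₂ , λ _ R⊆P R⊆Q → < R⊆P , R⊆Q >
      }
    ; maximum = λ _ _ → _
    ; minimum = λ _ ()
    }

-- Excluded middle is needed only for the complement law: the bounded lattice
-- underlying this Boolean algebra is ℘ W.
℘-booleanAlgebra : {ℓ : Level} → ExcludedMiddle ℓ → Set ℓ → BooleanAlgebra (suc ℓ) ℓ ℓ
℘-booleanAlgebra {ℓ} em W = record
  { ¬_               = ∁
  ; isBooleanAlgebra = record
    { isHeytingAlgebra = record
      { isBoundedLattice = BoundedLattice.isBoundedLattice (℘ W)
      ; exponential      = λ R P Q →
          (λ R∩P⊆Q {w} w∈R → case-P P Q w λ w∈P → R∩P⊆Q (w∈R , w∈P))
        , (λ R⊆∁P∪Q (w∈R , w∈P) →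
            [ (λ w∉P → contradiction w∈P w∉P) , (λ w∈Q → w∈Q) ] (R⊆∁P∪Q w∈R))
      }
    }
  }
  where
  case-P : ∀ (P Q : Pred W ℓ) w → (w ∈ P → w ∈ Q) → w ∈ ∁ P ∪ Q
  case-P P Q w f with em {P w}
  ... | yes w∈P = inj₂ (f w∈P)
  ... | no  w∉P = inj₁ w∉P

record SelectionFrame (ℓ : Level) : Set (suc ℓ) where
  field
    W         : Set ℓ
    nonempty  : W
    R         : Pred W ℓ → Rel W ℓ
    -- The family is indexed by subsets, so extensionally equal predicates
    -- index the same relation.
    R-cong    : {A B : Pred W ℓ} → A ≐ B → ∀ {w v} → R A w v → R B w v
    success   : ∀ {A w v} → R A w v → v ∈ A
    centering : ∀ {A w v} → w ∈ A → R A w v ⇔ (v ≡ w)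

  infixr 5 _→R_
  _→R_ : Op₂ (Pred W ℓ)
  (A →R B) w = ∀ v → R A w v → v ∈ B

StronglyDense : {ℓ : Level} → SelectionFrame ℓ → Set (suc ℓ)
StronglyDense {ℓ} F = (A B : Pred W ℓ) (w v : W) →
  R (A ∩ B) w v → ∃[ u ] (R A w u × R (A ∩ B) u v)
  where open SelectionFrame F

{-# OPTIONS --safe #-}
module Submission where

open import Defs
open import Data.Product.Base using (_,_; proj₁; swap)
open import Function.Bundles using (Equivalence)
open import Level using (Level)
open import Relation.Binary.PropositionalEquality using (refl; sym; subst)
open import Relation.Unary using (Pred; _∈_; _⊆_; _≐_)

-- Each axiom mirrors one frame condition. Centering makes `w` see itself under `U`, and only itself
-- under any `A` containing it: axioms (1), (2). Success gives (3), weakening the consequent (4),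
-- strong density (5).

module _ {ℓ : Level} (F : SelectionFrame ℓ) where
  open SelectionFrame F

  -- Used in both directions for congruence. The antecedent varies only up to `≐`, since `R` need
  -- not be monotone in its index.
  →R-mono : ∀ {A A′ B B′ : Pred W ℓ} → A ≐ A′ → B ⊆ B′ → (A →R B) ⊆ (A′ →R B′)
  →R-mono A≐A′ B⊆B′ w∈A→B v wRv = B⊆B′ (w∈A→B v (R-cong (swap A≐A′) wRv))

  centered-refl : ∀ {A : Pred W ℓ} {w} → w ∈ A → R A w w
  centered-refl w∈A = Equivalence.from (centering w∈A) refl

proposition6 : {ℓ : Level} (F : SelectionFrame ℓ) → StronglyDense F →
    IsPreconditional (℘ (SelectionFrame.W F)) (SelectionFrame._→R_ F)
proposition6 F dense = record
  { ⟶-cong        = λ { A≐A′ (B⊆B′ , B′⊆B) →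
                      →R-mono F A≐A′ B⊆B′ , →R-mono F (swap A≐A′) B′⊆B }
  ; ⊤⟶a≤a         = λ _ {w} w∈U→A → w∈U→A w (centered-refl F _)
  ; a∧b≤a⟶b       = λ _ B (w∈A , w∈B) v wRv →
                      subst B (sym (Equivalence.to (centering w∈A) wRv)) w∈B
  ; a⟶b≤a⟶a∧b     = λ _ _ w∈A→B v wRv → success wRv , w∈A→B v wRv
  ; a⟶b∧c≤a⟶b     = λ _ _ _ w∈A→B∩C v wRv → proj₁ (w∈A→B∩C v wRv)
  -- Density routes `w` to `v` through an `A`-successor `u`, where `h` supplies the inner
  -- conditional.
  ; a⟶a∧b⟶c≤a∧b⟶c = λ A B _ {w} h v wRv →
                      let u , wRu , uRv = dense A B w v wRv in h u wRu v uRv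
  }
  where open SelectionFrame F
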